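{- Define a translation $A\mapsto A_{\neg\neg}$ from formulas of QHC to formulas of intuitionistic predicate calculus QH by recursion: atomic problems (including $\bot$) are unchanged; $0_{\neg\neg}=\bot$; each atomic proposition $p(t_1,\dots,t_n)\ne 0$ is sent to $\neg\neg\bar p(t_1,\dots,t_n)$, where $\bar p$ is a problem variable of the same arity assigned injectively to $p$ (and distinct from the problem variables of QHC); intuitionistic connectives and quantifiers are kept; classical $\land,\to,\forall$ become intuitionistic ($(p\to q)_{\neg\neg}=p_{\neg\neg}\to q_{\neg\neg}$, etc.); classical $\lor,\exists$ become intuitionistic and prefixed by $\neg\neg$: $(p\lor q)_{\neg\neg}=\neg\neg(p_{\neg\neg}\lor q_{\neg\neg})$, $(\exists x\,p)_{\neg\neg}=\neg\neg\exists x\,p_{\neg\neg}$; $(!p)_{\neg\neg}=p_{\neg\neg}$; $(?\alpha)_{\neg\neg}=\neg\neg\alpha_{\neg\neg}$. Then if $A_1,\dots,A_n\vdash_{\mathrm{QHC}} A$, we have $(A_1)_{\neg\neg},\dots,(A_n)_{\neg\neg}\vdash_{\mathrm{QH}} A_{\neg\neg}$.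
   Context: QHC is a two-sorted first-order calculus. Its only terms are individual variables. Every formula is either a problem (denoted by Greek letters $\alpha,\beta,\gamma,\dots$) or a proposition (denoted by Latin letters $p,q,\dots$). Atomic formulas are proposition variables $p(t_1,\dots,t_n)$ (of proposition type), problem variables $\pi(t_1,\dots,t_n)$ (of problem type), and the constants $0$ (a proposition, classical falsity) and $\bot$ (a problem, intuitionistic absurdity). Propositions are closed under the classical connectives $\land,\lor,\to$ and quantifiers $\exists,\forall$; problems are closed under the intuitionistic connectives $\land,\lor,\to$ and quantifiers $\exists,\forall$ (the same symbols are used, distinguished by the type of the arguments). $\neg p$ abbreviates $p\to 0$, $\neg\alpha$ abbreviates $\alpha\to\bot$, and $\leftrightarrow$ is defined as usual. There are two type-conversion operators: if $p$ is a proposition then $!p$ is a problem, and if $\alpha$ is a problem then $?\alpha$ is a proposition. Deductive system of QHC: all axioms and rules of classical predicate logic applied to all propositions; all postulates and rules of intuitionistic predicate logic applied to all problems; the rules $p\,/\,!p$ and $\alpha\,/\,?\alpha$; and the schemas $?!p\to p$; $\alpha\to\, !?\alpha$; $!(p\to q)\to(!p\to !q)$; $?(\alpha\to\beta)\to(?\alpha\to ?\beta)$; $!0\to\bot$; $?(\alpha\land\beta)\leftrightarrow ?\alpha\land ?\beta$; $?(\alpha\lor\beta)\leftrightarrow ?\alpha\lor ?\beta$; $?\bot\to 0$; $?\exists x\,\alpha(x)\leftrightarrow\exists x\,?\alpha(x)$; $?\forall x\,\alpha(x)\to\forall x\,?\alpha(x)$ (usual variable side conditions implicit). $\vdash A$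 means $A$ is derivable in QHC; $A\Rightarrow B$ means $\vdash A\to B$ and $A\Leftrightarrow B$ means $\vdash A\leftrightarrow B$ (with $A,B$ of the same type); $A\vdash B$ means $B$ is derivable in QHC from the premise $A$. Notation: $\Box p := ?!p$ (a proposition) and $\nabla\alpha := !?\alpha$ (a problem). QC and QH denote classical and intuitionistic predicate calculus. -}

module Defs where

open import Data.Bool using (if_then_else_)
open import Data.List using (List)
open import Data.List.Membership.Propositional using () renaming (_∈_ to _∈ᴸ_)
open import Data.Nat using (ℕ; _≟_)
open import Data.Product using (Σ; _×_; _,_)
open import Data.Sum using (_⊎_)
open import Data.Unit using (⊤)
open import Data.Empty using () renaming (⊥ to Empty)
open import Data.Vec using (Vec) renaming (map to mapⱽ)
open import Data.Vec.Membership.Propositional using () renaming (_∈_ to _∈ⱽ_)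
open import Function.Definitions using (Injective)
open import Relation.Binary.PropositionalEquality using (_≡_; _≢_)
open import Relation.Nullary using (¬_; does)

-- Individual variables, which are the only terms.
Var : Set
Var = ℕ

_[_/_]ᵛ : Var → Var → Var → Var
y [ t / x ]ᵛ = if does (x ≟ y) then t else y

-- In both calculi below, A [ t / x ] is literal replacement of the free
-- occurrences of x, without renaming of bound variables; the axioms that use it
-- require that t be free for x in A.

-- Intuitionistic predicate calculus whose n-ary problem variables form V n.
module QH (V : ℕ → Set) where

  infixr 7 _∧_
  infixr 6 _∨_
  infixr 5 _⇒_
  infix  8 ∼_
  infix  3 _⊢_

  data Formula : Set where
    atom  : ∀ {n} → V n → Vec Var n → Formula
    ⊥     : Formula
    _∧_   : Formula → Formula → Formula
    _∨_   : Formula → Formula → Formula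
    _⇒_   : Formula → Formula → Formula
    all   : Var → Formula → Formula
    ex    : Var → Formula → Formula

  ∼_ : Formula → Formula
  ∼ A = A ⇒ ⊥

  _FreeIn_ : Var → Formula → Set
  x FreeIn atom v ts = x ∈ⱽ ts
  x FreeIn ⊥         = Empty
  x FreeIn (A ∧ B)   = x FreeIn A ⊎ x FreeIn B
  x FreeIn (A ∨ B)   = x FreeIn A ⊎ x FreeIn B
  x FreeIn (A ⇒ B)   = x FreeIn A ⊎ x FreeIn B
  x FreeIn all y A   = x ≢ y × x FreeIn A
  x FreeIn ex y A    = x ≢ y × x FreeIn A

  _[_/_] : Formula → Var → Var → Formula
  atom v ts [ t / x ] = atom v (mapⱽ (_[ t / x ]ᵛ) ts)
  ⊥         [ t / x ] = ⊥
  (A ∧ B)   [ t / x ] = A [ t / x ] ∧ B [ t / x ]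
  (A ∨ B)   [ t / x ] = A [ t / x ] ∨ B [ t / x ]
  (A ⇒ B)   [ t / x ] = A [ t / x ] ⇒ B [ t / x ]
  all y A   [ t / x ] = all y (if does (x ≟ y) then A else A [ t / x ])
  ex y A    [ t / x ] = ex y (if does (x ≟ y) then A else A [ t / x ])

  FreeFor : Var → Var → Formula → Set
  FreeFor t x (atom v ts) = ⊤
  FreeFor t x ⊥           = ⊤
  FreeFor t x (A ∧ B)     = FreeFor t x A × FreeFor t x B
  FreeFor t x (A ∨ B)     = FreeFor t x A × FreeFor t x B
  FreeFor t x (A ⇒ B)     = FreeFor t x A × FreeFor t x B
  FreeFor t x (all y A)   = ¬ (x FreeIn all y A) ⊎ (t ≢ y × FreeFor t x A)
  FreeFor t x (ex y A)    = ¬ (x FreeIn ex y A) ⊎ (t ≢ y × FreeFor t x A)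

  -- Premises may contain free variables, and generalization is applicable to
  -- everything derived from them.
  data _⊢_ (Γ : List Formula) : Formula → Set where
    premise : ∀ {A} → A ∈ᴸ Γ → Γ ⊢ A
    mp      : ∀ {A B} → Γ ⊢ A ⇒ B → Γ ⊢ A → Γ ⊢ B
    gen     : ∀ {A} x → Γ ⊢ A → Γ ⊢ all x A

    ax-K    : ∀ {A B} → Γ ⊢ A ⇒ B ⇒ A
    ax-S    : ∀ {A B C} → Γ ⊢ (A ⇒ B ⇒ C) ⇒ (A ⇒ B) ⇒ A ⇒ C
    ax-∧E₁  : ∀ {A B} → Γ ⊢ A ∧ B ⇒ A
    ax-∧E₂  : ∀ {A B} → Γ ⊢ A ∧ B ⇒ B
    ax-∧I   : ∀ {A B} → Γ ⊢ A ⇒ B ⇒ A ∧ B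
    ax-∨I₁  : ∀ {A B} → Γ ⊢ A ⇒ A ∨ B
    ax-∨I₂  : ∀ {A B} → Γ ⊢ B ⇒ A ∨ B
    ax-∨E   : ∀ {A B C} → Γ ⊢ (A ⇒ C) ⇒ (B ⇒ C) ⇒ A ∨ B ⇒ C
    ax-⊥E   : ∀ {A} → Γ ⊢ ⊥ ⇒ A
    ax-∀E   : ∀ {A} x t → FreeFor t x A → Γ ⊢ all x A ⇒ A [ t / x ]
    ax-∃I   : ∀ {A} x t → FreeFor t x A → Γ ⊢ A [ t / x ] ⇒ ex x A
    ax-∀I   : ∀ {A B} x → ¬ (x FreeIn B) →
              Γ ⊢ all x (B ⇒ A) ⇒ B ⇒ all x A
    ax-∃E   : ∀ {A B} x → ¬ (x FreeIn B) →
              Γ ⊢ all x (A ⇒ B) ⇒ ex x A ⇒ B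

data Sort : Set where
  proposition problem : Sort

-- The joint calculus whose n-ary proposition variables form P n and whose n-ary
-- problem variables form Π n.
module QHC (P Π : ℕ → Set) where

  infixr 7 _∧_
  infixr 6 _∨_
  infixr 5 _⇒_
  infix  4 _⇔_
  infix  8 ∼_ !_ ⁇_
  infix  3 _⊢_

  data Formula : Sort → Set where
    propAtom : ∀ {n} → P n → Vec Var n → Formula proposition
    probAtom : ∀ {n} → Π n → Vec Var n → Formula problem
    𝟎        : Formula proposition
    ⊥        : Formula problem
    _∧_      : ∀ {s} → Formula s → Formula s → Formula s
    _∨_      : ∀ {s} → Formula s → Formula s → Formula s
    _⇒_      : ∀ {s} → Formula s → Formula s → Formula s
    all      : ∀ {s} → Var → Formula s → Formula s
    ex       : ∀ {s} → Var → Formula s → Formula s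
    !_       : Formula proposition → Formula problem
    -- The operator written "?" on paper; that token is reserved in Agda.
    ⁇_       : Formula problem → Formula proposition

  AnyFormula : Set
  AnyFormula = Σ Sort Formula

  falsity : ∀ s → Formula s
  falsity proposition = 𝟎
  falsity problem     = ⊥

  ∼_ : ∀ {s} → Formula s → Formula s
  ∼_ {s} A = A ⇒ falsity s

  _⇔_ : ∀ {s} → Formula s → Formula s → Formula s
  A ⇔ B = (A ⇒ B) ∧ (B ⇒ A)

  _FreeIn_ : ∀ {s} → Var → Formula s → Set
  x FreeIn propAtom p ts = x ∈ⱽ ts
  x FreeIn probAtom π ts = x ∈ⱽ ts
  x FreeIn 𝟎             = Empty
  x FreeIn ⊥             = Empty
  x FreeIn (A ∧ B)       = x FreeIn A ⊎ x FreeIn B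
  x FreeIn (A ∨ B)       = x FreeIn A ⊎ x FreeIn B
  x FreeIn (A ⇒ B)       = x FreeIn A ⊎ x FreeIn B
  x FreeIn all y A       = x ≢ y × x FreeIn A
  x FreeIn ex y A        = x ≢ y × x FreeIn A
  x FreeIn (! A)         = x FreeIn A
  x FreeIn (⁇ A)         = x FreeIn A

  _[_/_] : ∀ {s} → Formula s → Var → Var → Formula s
  propAtom p ts [ t / x ] = propAtom p (mapⱽ (_[ t / x ]ᵛ) ts)
  probAtom π ts [ t / x ] = probAtom π (mapⱽ (_[ t / x ]ᵛ) ts)
  𝟎             [ t / x ] = 𝟎
  ⊥             [ t / x ] = ⊥
  (A ∧ B)       [ t / x ] = A [ t / x ] ∧ B [ t / x ]
  (A ∨ B)       [ t / x ] = A [ t / x ] ∨ B [ t / x ]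
  (A ⇒ B)       [ t / x ] = A [ t / x ] ⇒ B [ t / x ]
  all y A       [ t / x ] = all y (if does (x ≟ y) then A else A [ t / x ])
  ex y A        [ t / x ] = ex y (if does (x ≟ y) then A else A [ t / x ])
  (! A)         [ t / x ] = ! (A [ t / x ])
  (⁇ A)         [ t / x ] = ⁇ (A [ t / x ])

  FreeFor : ∀ {s} → Var → Var → Formula s → Set
  FreeFor t x (propAtom p ts) = ⊤
  FreeFor t x (probAtom π ts) = ⊤
  FreeFor t x 𝟎               = ⊤
  FreeFor t x ⊥               = ⊤
  FreeFor t x (A ∧ B)         = FreeFor t x A × FreeFor t x B
  FreeFor t x (A ∨ B)         = FreeFor t x A × FreeFor t x B
  FreeFor t x (A ⇒ B)         = FreeFor t x A × FreeFor t x B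
  FreeFor t x (all y A)       = ¬ (x FreeIn all y A) ⊎ (t ≢ y × FreeFor t x A)
  FreeFor t x (ex y A)        = ¬ (x FreeIn ex y A) ⊎ (t ≢ y × FreeFor t x A)
  FreeFor t x (! A)           = FreeFor t x A
  FreeFor t x (⁇ A)           = FreeFor t x A

  -- The postulates that classical and intuitionistic predicate logic have in
  -- common are stated once, for an arbitrary sort s.
  data _⊢_ (Γ : List AnyFormula) : ∀ {s} → Formula s → Set where
    premise : ∀ {s} {A : Formula s} → (s , A) ∈ᴸ Γ → Γ ⊢ A
    mp      : ∀ {s} {A B : Formula s} → Γ ⊢ A ⇒ B → Γ ⊢ A → Γ ⊢ B
    gen     : ∀ {s} {A : Formula s} x → Γ ⊢ A → Γ ⊢ all x A

    ax-K    : ∀ {s} {A B : Formula s} → Γ ⊢ A ⇒ B ⇒ A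
    ax-S    : ∀ {s} {A B C : Formula s} →
              Γ ⊢ (A ⇒ B ⇒ C) ⇒ (A ⇒ B) ⇒ A ⇒ C
    ax-∧E₁  : ∀ {s} {A B : Formula s} → Γ ⊢ A ∧ B ⇒ A
    ax-∧E₂  : ∀ {s} {A B : Formula s} → Γ ⊢ A ∧ B ⇒ B
    ax-∧I   : ∀ {s} {A B : Formula s} → Γ ⊢ A ⇒ B ⇒ A ∧ B
    ax-∨I₁  : ∀ {s} {A B : Formula s} → Γ ⊢ A ⇒ A ∨ B
    ax-∨I₂  : ∀ {s} {A B : Formula s} → Γ ⊢ B ⇒ A ∨ B
    ax-∨E   : ∀ {s} {A B C : Formula s} →
              Γ ⊢ (A ⇒ C) ⇒ (B ⇒ C) ⇒ A ∨ B ⇒ C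
    ax-⊥E   : ∀ {s} {A : Formula s} → Γ ⊢ falsity s ⇒ A
    ax-∀E   : ∀ {s} {A : Formula s} x t → FreeFor t x A →
              Γ ⊢ all x A ⇒ A [ t / x ]
    ax-∃I   : ∀ {s} {A : Formula s} x t → FreeFor t x A →
              Γ ⊢ A [ t / x ] ⇒ ex x A
    ax-∀I   : ∀ {s} {A B : Formula s} x → ¬ (x FreeIn B) →
              Γ ⊢ all x (B ⇒ A) ⇒ B ⇒ all x A
    ax-∃E   : ∀ {s} {A B : Formula s} x → ¬ (x FreeIn B) →
              Γ ⊢ all x (A ⇒ B) ⇒ ex x A ⇒ B

    ax-LEM  : ∀ {p : Formula proposition} → Γ ⊢ p ∨ ∼ p

    !-intro : ∀ {p} → Γ ⊢ p → Γ ⊢ ! p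
    ⁇-intro : ∀ {α} → Γ ⊢ α → Γ ⊢ ⁇ α
    ax-⁇!   : ∀ {p} → Γ ⊢ ⁇ ! p ⇒ p
    ax-!⁇   : ∀ {α} → Γ ⊢ α ⇒ ! ⁇ α
    ax-!⇒   : ∀ {p q} → Γ ⊢ ! (p ⇒ q) ⇒ (! p ⇒ ! q)
    ax-⁇⇒   : ∀ {α β} → Γ ⊢ ⁇ (α ⇒ β) ⇒ (⁇ α ⇒ ⁇ β)
    ax-!𝟎   : Γ ⊢ ! 𝟎 ⇒ ⊥
    ax-⁇∧   : ∀ {α β} → Γ ⊢ ⁇ (α ∧ β) ⇔ ⁇ α ∧ ⁇ β
    ax-⁇∨   : ∀ {α β} → Γ ⊢ ⁇ (α ∨ β) ⇔ ⁇ α ∨ ⁇ β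
    ax-⁇⊥   : Γ ⊢ ⁇ ⊥ ⇒ 𝟎
    ax-⁇∃   : ∀ {α} x → Γ ⊢ ⁇ ex x α ⇔ ex x (⁇ α)
    ax-⁇∀   : ∀ {α} x → Γ ⊢ ⁇ all x α ⇒ all x (⁇ α)

-- A choice, in a language with problem variables V, of a copy of the problem
-- variables Π and of a fresh problem variable for each proposition variable.
record BarAssignment (P Π V : ℕ → Set) : Set where
  field
    incl           : ∀ {n} → Π n → V n
    bar            : ∀ {n} → P n → V n
    incl-injective : ∀ {n} → Injective _≡_ _≡_ (incl {n})
    bar-injective  : ∀ {n} → Injective _≡_ _≡_ (bar {n})
    bar≢incl       : ∀ {n} (p : P n) (π : Π n) → bar p ≢ incl π

module Translation {P Π V : ℕ → Set} (b : BarAssignment P Π V) where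
  open BarAssignment b
  open QHC P Π using (AnyFormula; propAtom; probAtom; 𝟎; ⊥; _∧_; _∨_; _⇒_; all; ex; !_; ⁇_)
  private module I = QH V

  _¬¬ : ∀ {s} → QHC.Formula P Π s → I.Formula
  propAtom p ts ¬¬             = I.∼ I.∼ I.atom (bar p) ts
  probAtom π ts ¬¬             = I.atom (incl π) ts
  𝟎 ¬¬                         = I.⊥
  ⊥ ¬¬                         = I.⊥
  (A ∧ B) ¬¬                   = (A ¬¬) I.∧ (B ¬¬)
  _¬¬ {proposition} (A ∨ B)    = I.∼ I.∼ ((A ¬¬) I.∨ (B ¬¬))
  _¬¬ {problem}     (A ∨ B)    = (A ¬¬) I.∨ (B ¬¬)
  (A ⇒ B) ¬¬                   = (A ¬¬) I.⇒ (B ¬¬)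
  all x A ¬¬                   = I.all x (A ¬¬)
  _¬¬ {proposition} (ex x A)   = I.∼ I.∼ I.ex x (A ¬¬)
  _¬¬ {problem}     (ex x A)   = I.ex x (A ¬¬)
  (! A) ¬¬                     = A ¬¬
  (⁇ A) ¬¬                     = I.∼ I.∼ (A ¬¬)

  translate : AnyFormula → I.Formula
  translate (_ , A) = A ¬¬

{-# OPTIONS --safe #-}
module Submission where

open import Defs
open import Data.Bool using (T; true; false)
open import Data.List using (List; []; _∷_; map)
open import Data.List.Membership.Propositional using (_∈_)
open import Data.List.Membership.Propositional.Properties using (∈-map⁺)
open import Data.List.Relation.Unary.Any using (here; there)
open import Data.Nat using (ℕ; _≟_; _≡ᵇ_)
open import Data.Nat.Properties using (≡ᵇ⇒≡)
open import Data.Product as Product using (_,_)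
open import Data.Sum as Sum using (inj₁; inj₂)
open import Data.Vec.Properties using (map-cong; map-id)
open import Function using (_∘_)
open import Relation.Binary.PropositionalEquality using (_≡_; refl; sym; trans; cong; cong₂; subst)
open import Relation.Nullary using (¬_; yes; no)

-- The translation commutes with substitution and creates no free variables, and
-- the translation of every proposition is ¬¬-stable in QH.  Stability is what
-- makes the translated eliminations of classical ∨ and ∃, and the schema
-- ?!p → p, derivable; all other schemas are intuitionistic facts about ¬¬.

-- Replacing a variable by itself.

[x/x]ᵛ : ∀ x y → y [ x / x ]ᵛ ≡ y
-- `does (x ≟ y)` computes to `x ≡ᵇ y`, so abstracting the Boolean lets the conditional reduce. The
-- later substitution lemmas split in the same way.
[x/x]ᵛ x y with x ≡ᵇ y in eq
... | true  = ≡ᵇ⇒≡ x y (subst T (sym eq) _)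
... | false = refl

module Intuitionistic (V : ℕ → Set) where
  open QH V

  [x/x] : ∀ x A → A [ x / x ] ≡ A
  [x/x] x (atom v ts) = cong (atom v) (trans (map-cong ([x/x]ᵛ x) ts) (map-id ts))
  [x/x] x ⊥           = refl
  [x/x] x (A ∧ B)     = cong₂ _∧_ ([x/x] x A) ([x/x] x B)
  [x/x] x (A ∨ B)     = cong₂ _∨_ ([x/x] x A) ([x/x] x B)
  [x/x] x (A ⇒ B)     = cong₂ _⇒_ ([x/x] x A) ([x/x] x B)
  [x/x] x (all y A) with x ≡ᵇ y
  ... | true  = refl
  ... | false = cong (all y) ([x/x] x A)
  [x/x] x (ex y A) with x ≡ᵇ y
  ... | true  = refl
  ... | false = cong (ex y) ([x/x] x A)

  freeFor-refl : ∀ x A → FreeFor x x A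
  freeFor-refl x (atom v ts) = _
  freeFor-refl x ⊥           = _
  freeFor-refl x (A ∧ B)     = freeFor-refl x A , freeFor-refl x B
  freeFor-refl x (A ∨ B)     = freeFor-refl x A , freeFor-refl x B
  freeFor-refl x (A ⇒ B)     = freeFor-refl x A , freeFor-refl x B
  freeFor-refl x (all y A) with x ≟ y
  ... | yes x≡y = inj₁ λ (x≢y , _) → x≢y x≡y
  ... | no  x≢y = inj₂ (x≢y , freeFor-refl x A)
  freeFor-refl x (ex y A) with x ≟ y
  ... | yes x≡y = inj₁ λ (x≢y , _) → x≢y x≡y
  ... | no  x≢y = inj₂ (x≢y , freeFor-refl x A)

  -- Deduction theorem and derived quantifier rules.

  module _ {Γ : List Formula} where

    infixl 9 _·_
    infix  3 _⊩_

    -- Applicative terms over the theorems of Γ; the local hypotheses Δ, unlike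
    -- the premises Γ, may be discharged because gen is not applied under them.
    data _⊩_ (Δ : List Formula) : Formula → Set where
      var : ∀ {A} → A ∈ Δ → Δ ⊩ A
      thm : ∀ {A} → Γ ⊢ A → Δ ⊩ A
      _·_ : ∀ {A B} → Δ ⊩ A ⇒ B → Δ ⊩ A → Δ ⊩ B

    pattern v₀ = var (here refl)
    pattern v₁ = var (there (here refl))
    pattern v₂ = var (there (there (here refl)))
    pattern v₃ = var (there (there (there (here refl))))

    -- The deduction theorem, by bracket abstraction into `ax-K` and `ax-S`. Generalizations occur
    -- only inside `thm`, whose content is constant in the discharged hypothesis.
    ƛ_ : ∀ {Δ A B} → A ∷ Δ ⊩ B → Δ ⊩ A ⇒ B
    -- The identity as S K K; the formula `B` of the last K is arbitrary and is fixed as `A`.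
    ƛ_ {A = A} v₀    = thm ax-S · thm ax-K · thm (ax-K {B = A})
    ƛ var (there i)  = thm ax-K · var i
    ƛ thm d          = thm ax-K · thm d
    ƛ (t · u)        = thm ax-S · (ƛ t) · (ƛ u)

    infixr 4 ƛ_

    closed : ∀ {A} → [] ⊩ A → Γ ⊢ A
    closed (thm d) = d
    closed (t · u) = mp (closed t) (closed u)

    ⇒-refl : ∀ {A} → Γ ⊢ A ⇒ A
    ⇒-refl = closed (ƛ v₀)

    ∀E : ∀ x {A} → Γ ⊢ all x A ⇒ A
    ∀E x {A} = subst (λ B → Γ ⊢ all x A ⇒ B) ([x/x] x A) (ax-∀E x x (freeFor-refl x A))

    ∃I : ∀ x {A} → Γ ⊢ A ⇒ ex x A
    ∃I x {A} = subst (λ B → Γ ⊢ B ⇒ ex x A) ([x/x] x A) (ax-∃I x x (freeFor-refl x A))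

    ∀I-rule : ∀ x {A B} → ¬ (x FreeIn B) → Γ ⊢ B ⇒ A → Γ ⊢ B ⇒ all x A
    ∀I-rule x x∉B d = mp (ax-∀I x x∉B) (gen x d)

    ∃E-rule : ∀ x {A B} → ¬ (x FreeIn B) → Γ ⊢ A ⇒ B → Γ ⊢ ex x A ⇒ B
    ∃E-rule x x∉B d = mp (ax-∃E x x∉B) (gen x d)

    ∧I-rule : ∀ {A B} → Γ ⊢ A → Γ ⊢ B → Γ ⊢ A ∧ B
    ∧I-rule d e = mp (mp ax-∧I d) e

    -- Double negation and the connectives.

    ∼∼-intro : ∀ {A} → Γ ⊢ A ⇒ ∼ ∼ A
    ∼∼-intro = closed (ƛ ƛ v₀ · v₁)

    ∼∼-map : ∀ {A B} → Γ ⊢ (A ⇒ B) ⇒ ∼ ∼ A ⇒ ∼ ∼ B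
    ∼∼-map = closed (ƛ ƛ ƛ v₁ · (ƛ v₁ · (v₃ · v₀)))

    ∼∼-ap : ∀ {A B} → Γ ⊢ ∼ ∼ (A ⇒ B) ⇒ ∼ ∼ A ⇒ ∼ ∼ B
    ∼∼-ap = closed (ƛ ƛ ƛ v₂ · (ƛ v₂ · (ƛ v₂ · (v₁ · v₀))))

    ∼∼-LEM : ∀ {A} → Γ ⊢ ∼ ∼ (A ∨ ∼ A)
    ∼∼-LEM = closed (ƛ v₀ · (thm ax-∨I₂ · (ƛ v₁ · (thm ax-∨I₁ · v₀))))

    ∼∼∧ : ∀ {A B} → Γ ⊢ ∼ ∼ (A ∧ B) ⇒ ∼ ∼ A ∧ ∼ ∼ B
    ∼∼∧ = closed (ƛ thm ax-∧I · (thm (mp ∼∼-map ax-∧E₁) · v₀) · (thm (mp ∼∼-map ax-∧E₂) · v₀))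

    ∧∼∼ : ∀ {A B} → Γ ⊢ ∼ ∼ A ∧ ∼ ∼ B ⇒ ∼ ∼ (A ∧ B)
    ∧∼∼ = closed (ƛ thm ∼∼-ap · (thm (mp ∼∼-map ax-∧I) · (thm ax-∧E₁ · v₀)) · (thm ax-∧E₂ · v₀))

    -- Since `x` is bound in `∼ ∼ all x A`, it suffices to derive `B` from it, by instantiating
    -- under `∼ ∼`. Taking `B` as `A` gives stability of `all`; taking `B` as `∼ ∼ A` gives the
    -- translated `ax-⁇∀`.
    ∼∼∀-map : ∀ x {A B} → Γ ⊢ ∼ ∼ A ⇒ B → Γ ⊢ ∼ ∼ all x A ⇒ all x B
    ∼∼∀-map x {A} d = ∀I-rule x x∉ (closed (ƛ thm d · (thm (mp ∼∼-map (∀E x)) · v₀)))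
      where
      x∉ : ¬ (x FreeIn (∼ ∼ all x A))
      x∉ (inj₁ (inj₁ (x≢x , _))) = x≢x refl

    -- Stability and the eliminations it yields.

    Stable : Formula → Set
    Stable A = Γ ⊢ ∼ ∼ A ⇒ A

    -- Triple negation reduces to a single one. This covers every clause of the translation that
    -- starts with `∼ ∼`.
    ∼-stable : ∀ {A} → Stable (∼ A)
    ∼-stable = closed (ƛ ƛ v₁ · (ƛ v₀ · v₁))

    ⊥-stable : Stable ⊥
    ⊥-stable = closed (ƛ v₀ · (ƛ v₀))

    ∧-stable : ∀ {A B} → Stable A → Stable B → Stable (A ∧ B)
    ∧-stable a b = closed
      (ƛ thm ax-∧I · (thm a · (thm ax-∧E₁ · (thm ∼∼∧ · v₀))) · (thm b · (thm ax-∧E₂ · (thm ∼∼∧ · v₀))))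

    ⇒-stable : ∀ {A B} → Stable B → Stable (A ⇒ B)
    ⇒-stable b = closed (ƛ ƛ thm b · (thm ∼∼-ap · v₁ · (thm ∼∼-intro · v₀)))

    ∀-stable : ∀ x {A} → Stable A → Stable (all x A)
    ∀-stable x = ∼∼∀-map x

    -- A stable goal allows the double negation of a hypothesis to be stripped; the eliminations of
    -- the translated classical `∨` and `ex` rest on this.
    ∼∼-elim : ∀ {A C} → Stable C → Γ ⊢ (A ⇒ C) ⇒ ∼ ∼ A ⇒ C
    ∼∼-elim c = closed (ƛ ƛ thm c · (thm ∼∼-map · v₁ · v₀))

    ∼∼-bind : ∀ {A B} → Γ ⊢ A ⇒ ∼ ∼ B → Γ ⊢ ∼ ∼ A ⇒ ∼ ∼ B
    ∼∼-bind = mp (∼∼-elim ∼-stable)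

    ∼∼∨⇒∼∼∨∼∼ : ∀ {A B} → Γ ⊢ ∼ ∼ (A ∨ B) ⇒ ∼ ∼ (∼ ∼ A ∨ ∼ ∼ B)
    ∼∼∨⇒∼∼∨∼∼ = mp ∼∼-map (mp (mp ax-∨E (closed (ƛ thm ax-∨I₁ · (thm ∼∼-intro · v₀))))
                                          (closed (ƛ thm ax-∨I₂ · (thm ∼∼-intro · v₀))))

    ∼∼∨∼∼⇒∼∼∨ : ∀ {A B} → Γ ⊢ ∼ ∼ (∼ ∼ A ∨ ∼ ∼ B) ⇒ ∼ ∼ (A ∨ B)
    ∼∼∨∼∼⇒∼∼∨ = ∼∼-bind (mp (mp ax-∨E (mp ∼∼-map ax-∨I₁)) (mp ∼∼-map ax-∨I₂))

    ∼∼∃⇒∼∼∃∼∼ : ∀ x {A} → Γ ⊢ ∼ ∼ ex x A ⇒ ∼ ∼ ex x (∼ ∼ A)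
    ∼∼∃⇒∼∼∃∼∼ x = mp ∼∼-map
      (∃E-rule x (λ (x≢x , _) → x≢x refl) (closed (ƛ thm (∃I x) · (thm ∼∼-intro · v₀))))

    ∼∼∃∼∼⇒∼∼∃ : ∀ x {A} → Γ ⊢ ∼ ∼ ex x (∼ ∼ A) ⇒ ∼ ∼ ex x A
    ∼∼∃∼∼⇒∼∼∃ x {A} = ∼∼-bind (∃E-rule x x∉ (mp ∼∼-map (∃I x)))
      where
      x∉ : ¬ (x FreeIn (∼ ∼ ex x A))
      x∉ (inj₁ (inj₁ (x≢x , _))) = x≢x refl

    ∼∼∨-elim : ∀ {A B C} → Stable C → Γ ⊢ (A ⇒ C) ⇒ (B ⇒ C) ⇒ ∼ ∼ (A ∨ B) ⇒ C
    ∼∼∨-elim c = closed (ƛ ƛ thm (∼∼-elim c) · (thm ax-∨E · v₁ · v₀))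

    ∼∼∃-elim : ∀ x {A C} → Stable C → ¬ (x FreeIn C) → Γ ⊢ all x (A ⇒ C) ⇒ ∼ ∼ ex x A ⇒ C
    ∼∼∃-elim x c x∉C = closed (ƛ thm (∼∼-elim c) · (thm (ax-∃E x x∉C) · v₀))

    then-∼∼ : ∀ {A B} → Γ ⊢ A ⇒ B → Γ ⊢ A ⇒ ∼ ∼ B
    then-∼∼ d = closed (ƛ thm ∼∼-intro · (thm d · v₀))

-- The translation and its soundness.

module _ {P Π V : ℕ → Set} (b : BarAssignment P Π V) where
  open QHC P Π
  open Translation b
  open Intuitionistic V
  private module I = QH V

  -- Used contrapositively, it transports the side conditions of `ax-∀I` and `ax-∃E`, and the
  -- vacuous case of `FreeFor` at a quantifier.
  ¬¬-freeIn : ∀ {s} {x} (A : Formula s) → x I.FreeIn (A ¬¬) → x FreeIn A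
  ¬¬-freeIn (propAtom p ts) (inj₁ (inj₁ i)) = i
  ¬¬-freeIn (probAtom π ts) i = i
  ¬¬-freeIn (A ∧ B) = Sum.map (¬¬-freeIn A) (¬¬-freeIn B)
  ¬¬-freeIn {proposition} (A ∨ B) (inj₁ (inj₁ i)) = Sum.map (¬¬-freeIn A) (¬¬-freeIn B) i
  ¬¬-freeIn {problem} (A ∨ B) = Sum.map (¬¬-freeIn A) (¬¬-freeIn B)
  ¬¬-freeIn (A ⇒ B) = Sum.map (¬¬-freeIn A) (¬¬-freeIn B)
  ¬¬-freeIn (all y A) = Product.map₂ (¬¬-freeIn A)
  ¬¬-freeIn {proposition} (ex y A) (inj₁ (inj₁ i)) = Product.map₂ (¬¬-freeIn A) i
  ¬¬-freeIn {problem} (ex y A) = Product.map₂ (¬¬-freeIn A)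
  ¬¬-freeIn (! A) = ¬¬-freeIn A
  ¬¬-freeIn (⁇ A) (inj₁ (inj₁ i)) = ¬¬-freeIn A i

  ¬¬-freeFor : ∀ {s} {t x} (A : Formula s) → FreeFor t x A → I.FreeFor t x (A ¬¬)
  ¬¬-freeFor (propAtom p ts) _ = _
  ¬¬-freeFor (probAtom π ts) _ = _
  ¬¬-freeFor 𝟎 _ = _
  ¬¬-freeFor ⊥ _ = _
  ¬¬-freeFor (A ∧ B) = Product.map (¬¬-freeFor A) (¬¬-freeFor B)
  -- Each `_` is the trivial condition for the `⊥` of one of the two added negations.
  ¬¬-freeFor {proposition} (A ∨ B) f = (Product.map (¬¬-freeFor A) (¬¬-freeFor B) f , _) , _
  ¬¬-freeFor {problem} (A ∨ B) = Product.map (¬¬-freeFor A) (¬¬-freeFor B)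
  ¬¬-freeFor (A ⇒ B) = Product.map (¬¬-freeFor A) (¬¬-freeFor B)
  ¬¬-freeFor (all y A) = Sum.map (_∘ Product.map₂ (¬¬-freeIn A)) (Product.map₂ (¬¬-freeFor A))
  ¬¬-freeFor {proposition} (ex y A) f =
    (Sum.map (_∘ Product.map₂ (¬¬-freeIn A)) (Product.map₂ (¬¬-freeFor A)) f , _) , _
  ¬¬-freeFor {problem} (ex y A) = Sum.map (_∘ Product.map₂ (¬¬-freeIn A)) (Product.map₂ (¬¬-freeFor A))
  ¬¬-freeFor (! A) = ¬¬-freeFor A
  ¬¬-freeFor (⁇ A) f = (¬¬-freeFor A f , _) , _

  ¬¬-subst : ∀ {s} t x (A : Formula s) → (A [ t / x ]) ¬¬ ≡ (A ¬¬) I.[ t / x ]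
  ¬¬-subst t x (propAtom p ts) = refl
  ¬¬-subst t x (probAtom π ts) = refl
  ¬¬-subst t x 𝟎 = refl
  ¬¬-subst t x ⊥ = refl
  ¬¬-subst t x (A ∧ B) = cong₂ I._∧_ (¬¬-subst t x A) (¬¬-subst t x B)
  ¬¬-subst {proposition} t x (A ∨ B) = cong₂ (λ C D → I.∼ I.∼ (C I.∨ D)) (¬¬-subst t x A) (¬¬-subst t x B)
  ¬¬-subst {problem} t x (A ∨ B) = cong₂ I._∨_ (¬¬-subst t x A) (¬¬-subst t x B)
  ¬¬-subst t x (A ⇒ B) = cong₂ I._⇒_ (¬¬-subst t x A) (¬¬-subst t x B)
  ¬¬-subst t x (all y A) with x ≡ᵇ y
  ... | true  = refl
  ... | false = cong (I.all y) (¬¬-subst t x A)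
  ¬¬-subst {proposition} t x (ex y A) with x ≡ᵇ y
  ... | true  = refl
  ... | false = cong (λ C → I.∼ I.∼ I.ex y C) (¬¬-subst t x A)
  ¬¬-subst {problem} t x (ex y A) with x ≡ᵇ y
  ... | true  = refl
  ... | false = cong (I.ex y) (¬¬-subst t x A)
  ¬¬-subst t x (! A) = ¬¬-subst t x A
  ¬¬-subst t x (⁇ A) = cong (λ C → I.∼ I.∼ C) (¬¬-subst t x A)

  -- Induction on `p`: `∧`, `⇒` and `all` inherit stability, `𝟎` becomes `⊥`, and every other
  -- constructor contributes an outer `∼ ∼`.
  proposition-stable : ∀ {Γ} (p : Formula proposition) → Stable {Γ} (p ¬¬)
  proposition-stable (propAtom p ts) = ∼-stable
  proposition-stable 𝟎 = ⊥-stable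
  proposition-stable (p ∧ q) = ∧-stable (proposition-stable p) (proposition-stable q)
  proposition-stable (p ∨ q) = ∼-stable
  proposition-stable (p ⇒ q) = ⇒-stable (proposition-stable q)
  proposition-stable (all x p) = ∀-stable x (proposition-stable p)
  proposition-stable (ex x p) = ∼-stable
  proposition-stable (⁇ α) = ∼-stable

  ¬¬-sound : ∀ {Γ s} {A : Formula s} → Γ ⊢ A → map translate Γ I.⊢ A ¬¬
  ¬¬-sound (premise i) = I.premise (∈-map⁺ translate i)
  ¬¬-sound (mp d e) = I.mp (¬¬-sound d) (¬¬-sound e)
  ¬¬-sound (gen x d) = I.gen x (¬¬-sound d)
  ¬¬-sound ax-K = I.ax-K
  ¬¬-sound ax-S = I.ax-S
  ¬¬-sound ax-∧E₁ = I.ax-∧E₁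
  ¬¬-sound ax-∧E₂ = I.ax-∧E₂
  ¬¬-sound ax-∧I = I.ax-∧I
  ¬¬-sound {s = proposition} ax-∨I₁ = then-∼∼ I.ax-∨I₁
  ¬¬-sound {s = problem} ax-∨I₁ = I.ax-∨I₁
  ¬¬-sound {s = proposition} ax-∨I₂ = then-∼∼ I.ax-∨I₂
  ¬¬-sound {s = problem} ax-∨I₂ = I.ax-∨I₂
  ¬¬-sound {s = proposition} (ax-∨E {C = r}) = ∼∼∨-elim (proposition-stable r)
  ¬¬-sound {s = problem} ax-∨E = I.ax-∨E
  -- The split on the sort makes `falsity s` reduce; both `𝟎` and `⊥` become `I.⊥`.
  ¬¬-sound {s = proposition} ax-⊥E = I.ax-⊥E
  ¬¬-sound {s = problem} ax-⊥E = I.ax-⊥E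
  ¬¬-sound {Γ} (ax-∀E {A = A} x t f) =
    subst (λ B → map translate Γ I.⊢ I.all x (A ¬¬) I.⇒ B) (sym (¬¬-subst t x A))
      (I.ax-∀E x t (¬¬-freeFor A f))
  ¬¬-sound {Γ} {proposition} (ax-∃I {A = A} x t f) =
    subst (λ B → map translate Γ I.⊢ B I.⇒ I.∼ I.∼ I.ex x (A ¬¬)) (sym (¬¬-subst t x A))
      (then-∼∼ (I.ax-∃I x t (¬¬-freeFor A f)))
  ¬¬-sound {Γ} {problem} (ax-∃I {A = A} x t f) =
    subst (λ B → map translate Γ I.⊢ B I.⇒ I.ex x (A ¬¬)) (sym (¬¬-subst t x A))
      (I.ax-∃I x t (¬¬-freeFor A f))
  ¬¬-sound (ax-∀I {B = B} x x∉B) = I.ax-∀I x (x∉B ∘ ¬¬-freeIn B)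
  ¬¬-sound {s = proposition} (ax-∃E {B = B} x x∉B) =
    ∼∼∃-elim x (proposition-stable B) (x∉B ∘ ¬¬-freeIn B)
  ¬¬-sound {s = problem} (ax-∃E {B = B} x x∉B) = I.ax-∃E x (x∉B ∘ ¬¬-freeIn B)
  -- As `𝟎` is sent to `⊥`, the translation of `∼ p` is the intuitionistic negation of `p ¬¬`.
  ¬¬-sound ax-LEM = ∼∼-LEM
  -- The translation erases `!` and turns `⁇` into `∼ ∼`. Hence `ax-⁇!` becomes stability, `ax-!⁇`
  -- becomes `∼∼-intro`, and `ax-!⇒` and `ax-!𝟎` become identities.
  ¬¬-sound (!-intro d) = ¬¬-sound d
  ¬¬-sound (⁇-intro d) = I.mp ∼∼-intro (¬¬-sound d)
  ¬¬-sound (ax-⁇! {p = p}) = proposition-stable p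
  ¬¬-sound ax-!⁇ = ∼∼-intro
  ¬¬-sound ax-!⇒ = ⇒-refl
  ¬¬-sound ax-⁇⇒ = ∼∼-ap
  ¬¬-sound ax-!𝟎 = ⇒-refl
  ¬¬-sound ax-⁇∧ = ∧I-rule ∼∼∧ ∧∼∼
  ¬¬-sound ax-⁇∨ = ∧I-rule ∼∼∨⇒∼∼∨∼∼ ∼∼∨∼∼⇒∼∼∨
  ¬¬-sound ax-⁇⊥ = ⊥-stable
  ¬¬-sound (ax-⁇∃ x) = ∧I-rule (∼∼∃⇒∼∼∃∼∼ x) (∼∼∃∼∼⇒∼∼∃ x)
  ¬¬-sound (ax-⁇∀ x) = ∼∼∀-map x ⇒-refl

theorem3p4 : {P Π V : ℕ → Set} (b : BarAssignment P Π V) →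
    (Γ : List (QHC.AnyFormula P Π)) {s : Sort} (A : QHC.Formula P Π s) →
    QHC._⊢_ P Π Γ A →
    QH._⊢_ V (map (Translation.translate b) Γ) (Translation._¬¬ b A)
theorem3p4 b Γ A d = ¬¬-sound b d
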